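{- For every nonnegative integer $n$, $$\sum_{k=0}^{\infty}(-1)^k(4k+1)\,\frac{(-2n)_k\,(-n+\tfrac14)_k\,(\tfrac12)_k}{k!\,(n+\tfrac54)_k\,(2n+\tfrac32)_k}=\left(\frac{2^2}{3^3}\right)^n\frac{(\tfrac54)_n^2}{(\tfrac{13}{12})_n(\tfrac{5}{12})_n}.$$ (The sum is finite, since $(-2n)_k=0$ for $k>2n$.)
   Context: $(a)_j=\Gamma(a+j)/\Gamma(a)=a(a+1)\cdots(a+j-1)$ denotes the rising factorial (Pochhammer symbol), with $(a)_0=1$. -}

module Defs where

open import Algebra.Definitions.RawSemiring as RawSemiringDefs using ()
open import Data.Fin.Base using (toℕ)
open import Data.Integer.Base using (+_)
open import Data.Nat.Base as ℕ using (ℕ; zero; suc; _!)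
import Data.Nat.Properties as ℕ
open import Data.Product.Base using (∃-syntax; _×_)
open import Data.Rational.Base
open import Data.Rational.Literals using (fromℤ)
open import Data.Rational.Properties
open import Relation.Binary.PropositionalEquality using (_≡_)

open RawSemiringDefs +-*-rawSemiring public using (_^_; sum)

fromℕ : ℕ → ℚ
fromℕ n = fromℤ (+ n)

-- The product form a (a + 1) ⋯ (a + j - 1), which, unlike the quotient of
-- Gamma values, also makes sense when a is a nonpositive integer.
infix 9 ⟨_⟩_
⟨_⟩_ : ℚ → ℕ → ℚ
⟨ a ⟩ zero  = 1ℚ
⟨ a ⟩ suc j = ⟨ a ⟩ j * (a + fromℕ j)

-- A series over k = 0, 1, 2, … with only finitely many nonzero terms,
-- together with its value.
infix 4 _HasFiniteSum_
_HasFiniteSum_ : (ℕ → ℚ) → ℚ → Set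
f HasFiniteSum s =
  ∃[ N ] (∀ k → N ℕ.≤ k → f k ≡ 0ℚ) × sum {N} (λ i → f (toℕ i)) ≡ s

rising-pos : ∀ a .{{_ : Positive a}} j → Positive (⟨ a ⟩ j)
rising-pos a zero    = _
rising-pos a (suc j) =
  pos*pos⇒pos (⟨ a ⟩ j) {{rising-pos a j}} (a + fromℕ j)
    {{pos+nonNeg⇒pos a (fromℕ j)}}

shifted-rising-pos : ∀ m q .{{_ : Positive q}} j → Positive (⟨ fromℕ m + q ⟩ j)
shifted-rising-pos m q = rising-pos (fromℕ m + q) {{nonNeg+pos⇒pos (fromℕ m) q}}

factorial-pos : ∀ k → Positive (fromℕ (k !))
factorial-pos k with k ! | k ℕ.!≢0
... | suc _ | _ = _

summandDenominator : ℕ → ℕ → ℚ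
summandDenominator n k =
  fromℕ (k !) * ⟨ fromℕ n + + 5 / 4 ⟩ k * ⟨ fromℕ (2 ℕ.* n) + + 3 / 2 ⟩ k

summandDenominator≢0 : ∀ n k → NonZero (summandDenominator n k)
summandDenominator≢0 n k =
  pos⇒nonZero (summandDenominator n k)
    {{pos*pos⇒pos (x * y) {{pos*pos⇒pos x {{factorial-pos k}} y {{y>0}}}} z {{z>0}}}}
  where
  x = fromℕ (k !)
  y = ⟨ fromℕ n + + 5 / 4 ⟩ k
  z = ⟨ fromℕ (2 ℕ.* n) + + 3 / 2 ⟩ k
  y>0 = shifted-rising-pos n (+ 5 / 4) k
  z>0 = shifted-rising-pos (2 ℕ.* n) (+ 3 / 2) k

summand : ℕ → ℕ → ℚ
summand n k =
  (- 1ℚ) ^ k * fromℕ (4 ℕ.* k ℕ.+ 1) *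
  ((⟨ - fromℕ (2 ℕ.* n) ⟩ k * ⟨ - fromℕ n + + 1 / 4 ⟩ k * ⟨ + 1 / 2 ⟩ k)
    ÷ summandDenominator n k) {{summandDenominator≢0 n k}}

valueDenominator : ℕ → ℚ
valueDenominator n = ⟨ + 13 / 12 ⟩ n * ⟨ + 5 / 12 ⟩ n

valueDenominator≢0 : ∀ n → NonZero (valueDenominator n)
valueDenominator≢0 n =
  pos⇒nonZero (valueDenominator n)
    {{pos*pos⇒pos (⟨ + 13 / 12 ⟩ n) {{rising-pos (+ 13 / 12) n}}
                  (⟨ + 5 / 12 ⟩ n)  {{rising-pos (+ 5 / 12) n}}}}

value : ℕ → ℚ
value n =
  (+ (2 ℕ.^ 2) / (3 ℕ.^ 3)) ^ n *
  ((⟨ + 5 / 4 ⟩ n) ^ 2 ÷ valueDenominator n) {{valueDenominator≢0 n}}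

{-# OPTIONS --safe #-}
module Submission where

-- The series is twice the very-well-poised ₄F₃(-1) with a = 1/2, b = -2n and
-- c = 1/4 - n, a case of the summation
--   Σₖ (-1)ᵏ (a + 2k) (a)ₖ (-m)ₖ (c)ₖ / (k! (1+a+m)ₖ (1+a-c)ₖ) = a (1+a)ₘ / (1+a-c)ₘ.
-- That summation is proved by the Wilf–Zeilberger method: with d = 1+a-c and
-- e = 1+a+m, the combination (d+e-a-1) T(e+1,k) - e T(e,k) of its terms
-- telescopes in k.  The value (3/2)₂ₙ / (n+5/4)₂ₙ takes the required form
-- because (5/4)₃ₙ = (5/4)ₙ (n+5/4)₂ₙ splits by Gauss multiplication into
-- 27ⁿ (5/12)ₙ (3/4)ₙ (13/12)ₙ, and (3/2)₂ₙ into 4ⁿ (3/4)ₙ (5/4)ₙ.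

open import Defs
open import Algebra.Bundles using (CommutativeRing)
open import Data.Fin.Base using (toℕ)
open import Data.Integer.Base as ℤ using (+_)
import Data.Integer.Properties as ℤ
open import Data.Nat.Base as ℕ using (ℕ; zero; suc; _!)
import Data.Nat.Properties as ℕ
open import Data.Product.Base using (_,_)
open import Data.Rational.Base
open import Data.Rational.Properties
import Data.Rational.Unnormalised.Base as ℚᵘ
import Data.Rational.Unnormalised.Properties as ℚᵘ
open import Data.Sum.Base using (inj₁; inj₂)
open import Function.Base using (_∘_)
open import Level using (0ℓ)
open import Relation.Binary.PropositionalEquality
  using (_≡_; refl; sym; trans; cong; cong₂; module ≡-Reasoning)
open import Relation.Nullary.Decidable.Core using (dec⇒maybe)
open import Tactic.RingSolver using (solve-∀)
open import Tactic.RingSolver.Core.AlmostCommutativeRing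
  using (AlmostCommutativeRing; fromCommutativeRing)

open import Algebra.Properties.Semiring.Sum (CommutativeRing.semiring +-*-commutativeRing)
  using (sum-cong-≗; sum-replicate-zero; *-distribˡ-sum)
open import Algebra.Properties.CommutativeSemiring.Exp
  (CommutativeRing.commutativeSemiring +-*-commutativeRing) using (^-distrib-*)

open ≡-Reasoning

-- Embedding of the naturals and arithmetic of quotients.

ring : AlmostCommutativeRing 0ℓ 0ℓ
ring = fromCommutativeRing +-*-commutativeRing λ x → dec⇒maybe (0ℚ ≟ x)

2ℚ : ℚ
2ℚ = + 2 / 1

-- Among unnormalised fractions both sides have denominator 1, so an identity of integers remains
-- and no gcd has to be analysed.
fromℕ-+ : ∀ m n → fromℕ (m ℕ.+ n) ≡ fromℕ m + fromℕ n
fromℕ-+ m n = toℚᵘ-injective (ℚᵘ.≃-trans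
  (ℚᵘ.*≡* (cong (ℤ._* + 1) (cong₂ ℤ._+_ (sym (ℤ.*-identityʳ (+ m))) (sym (ℤ.*-identityʳ (+ n))))))
  (ℚᵘ.≃-sym (toℚᵘ-homo-+ (fromℕ m) (fromℕ n))))

fromℕ-* : ∀ m n → fromℕ (m ℕ.* n) ≡ fromℕ m * fromℕ n
fromℕ-* m n = toℚᵘ-injective (ℚᵘ.≃-trans
  (ℚᵘ.*≡* (cong (ℤ._* + 1) (ℤ.pos-* m n)))
  (ℚᵘ.≃-sym (toℚᵘ-homo-* (fromℕ m) (fromℕ n))))

*-cancelʳ : ∀ {p q} r .{{_ : NonZero r}} → p * r ≡ q * r → p ≡ q
*-cancelʳ {p} {q} r eq = begin
  p               ≡⟨ cancel p ⟨
  p * r * (1/ r)  ≡⟨ cong (_* (1/ r)) eq ⟩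
  q * r * (1/ r)  ≡⟨ cancel q ⟩
  q               ∎
  where
  cancel : ∀ x → x * r * (1/ r) ≡ x
  cancel x = trans (*-assoc x r (1/ r)) (trans (cong (x *_) (*-inverseʳ r)) (*-identityʳ x))

÷-*-cancel : ∀ x y .{{_ : NonZero y}} → (x ÷ y) * y ≡ x
÷-*-cancel x y = trans (*-assoc x (1/ y) y) (trans (cong (x *_) (*-inverseˡ y)) (*-identityʳ x))

÷-zero : ∀ {x y} .{{_ : NonZero y}} → x ≡ 0ℚ → x ÷ y ≡ 0ℚ
÷-zero {y = y} refl = *-zeroˡ (1/ y)

-- Clears denominators when one hypergeometric term is to be written as a rational multiple `r` of
-- another.
÷-cross : ∀ x {y} r x′ {y′} .{{_ : NonZero y}} .{{_ : NonZero y′}} →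
          x * y′ ≡ r * x′ * y → x ÷ y ≡ r * (x′ ÷ y′)
÷-cross x {y} r x′ {y′} eq = begin
  x * 1/ y                         ≡⟨ *-identityʳ (x * 1/ y) ⟨
  x * (1/ y) * 1ℚ                  ≡⟨ cong (x * (1/ y) *_) (*-inverseʳ y′) ⟨
  x * (1/ y) * (y′ * 1/ y′)        ≡⟨ swap x (1/ y) y′ (1/ y′) ⟩
  x * y′ * ((1/ y) * (1/ y′))      ≡⟨ cong (_* ((1/ y) * (1/ y′))) eq ⟩
  r * x′ * y * ((1/ y) * (1/ y′))  ≡⟨ regroup r x′ y (1/ y) (1/ y′) ⟩
  r * (x′ * 1/ y′) * (y * (1/ y))  ≡⟨ cong (r * (x′ * 1/ y′) *_) (*-inverseʳ y) ⟩
  r * (x′ * 1/ y′) * 1ℚ            ≡⟨ *-identityʳ (r * (x′ * 1/ y′)) ⟩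
  r * (x′ * 1/ y′)                 ∎
  where
  swap : ∀ x i y j → x * i * (y * j) ≡ x * y * (i * j)
  swap = solve-∀ ring
  regroup : ∀ r x y i j → r * x * y * (i * j) ≡ r * (x * j) * (y * i)
  regroup = solve-∀ ring

-- Rising factorials: splitting, Gauss multiplication, vanishing.

-- The definition peels off the last factor; peeling off the first is what links the parameters `e`
-- and `1ℚ + e`.
rising-step : ∀ a j → ⟨ a ⟩ suc j ≡ a * ⟨ 1ℚ + a ⟩ j
rising-step a zero    = trans (*-comm 1ℚ (a + 0ℚ)) (cong (_* 1ℚ) (+-identityʳ a))
rising-step a (suc j) = begin
  ⟨ a ⟩ suc j * (a + fromℕ (suc j))        ≡⟨ cong₂ (λ x y → x * (a + y)) (rising-step a j) (fromℕ-+ 1 j) ⟩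
  a * ⟨ 1ℚ + a ⟩ j * (a + (1ℚ + fromℕ j))  ≡⟨ regroup a (⟨ 1ℚ + a ⟩ j) (fromℕ j) ⟩
  a * (⟨ 1ℚ + a ⟩ j * (1ℚ + a + fromℕ j))  ∎
  where
  regroup : ∀ a r j → a * r * (a + (1ℚ + j)) ≡ a * (r * (1ℚ + a + j))
  regroup = solve-∀ ring

rising-+ : ∀ a m n → ⟨ a ⟩ (m ℕ.+ n) ≡ ⟨ a ⟩ m * ⟨ fromℕ m + a ⟩ n
rising-+ a m zero    = trans (cong (⟨ a ⟩_) (ℕ.+-identityʳ m)) (sym (*-identityʳ (⟨ a ⟩ m)))
rising-+ a m (suc n) = begin
  ⟨ a ⟩ (m ℕ.+ suc n)
    ≡⟨ cong (⟨ a ⟩_) (ℕ.+-suc m n) ⟩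
  ⟨ a ⟩ (m ℕ.+ n) * (a + fromℕ (m ℕ.+ n))
    ≡⟨ cong₂ (λ x y → x * (a + y)) (rising-+ a m n) (fromℕ-+ m n) ⟩
  ⟨ a ⟩ m * ⟨ fromℕ m + a ⟩ n * (a + (fromℕ m + fromℕ n))
    ≡⟨ regroup (⟨ a ⟩ m) (⟨ fromℕ m + a ⟩ n) a (fromℕ m) (fromℕ n) ⟩
  ⟨ a ⟩ m * (⟨ fromℕ m + a ⟩ n * (fromℕ m + a + fromℕ n)) ∎
  where
  regroup : ∀ x y a m n → x * y * (a + (m + n)) ≡ x * (y * (m + a + n))
  regroup = solve-∀ ring

-- The factors at even and odd positions are 2(a + i) and 2(a + ½ + i). The length is written
-- `n * 2` because it then unfolds by two factors whenever `n` grows by one.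
rising-duplication : ∀ a n → ⟨ 2ℚ * a ⟩ (n ℕ.* 2) ≡ fromℕ 4 ^ n * (⟨ a ⟩ n * ⟨ a + ½ ⟩ n)
rising-duplication a zero    = refl
rising-duplication a (suc n) = begin
  ⟨ 2ℚ * a ⟩ (n ℕ.* 2) * (2ℚ * a + fromℕ (n ℕ.* 2)) * (2ℚ * a + fromℕ (1 ℕ.+ n ℕ.* 2))
    ≡⟨ cong (λ y → ⟨ 2ℚ * a ⟩ (n ℕ.* 2) * (2ℚ * a + fromℕ (n ℕ.* 2)) * (2ℚ * a + y)) (fromℕ-+ 1 (n ℕ.* 2)) ⟩
  ⟨ 2ℚ * a ⟩ (n ℕ.* 2) * (2ℚ * a + fromℕ (n ℕ.* 2)) * (2ℚ * a + (1ℚ + fromℕ (n ℕ.* 2)))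
    ≡⟨ cong₂ (λ x y → x * (2ℚ * a + y) * (2ℚ * a + (1ℚ + y))) (rising-duplication a n) (fromℕ-* n 2) ⟩
  P * (X * Y) * (2ℚ * a + N * 2ℚ) * (2ℚ * a + (1ℚ + N * 2ℚ))
    ≡⟨ regroup P X Y a N ⟩
  fromℕ 4 * P * (X * (a + N) * (Y * (a + ½ + N))) ∎
  where
  N = fromℕ n
  P = fromℕ 4 ^ n
  X = ⟨ a ⟩ n
  Y = ⟨ a + ½ ⟩ n
  regroup : ∀ P X Y a N → P * (X * Y) * (2ℚ * a + N * 2ℚ) * (2ℚ * a + (1ℚ + N * 2ℚ))
                          ≡ fromℕ 4 * P * (X * (a + N) * (Y * (a + ½ + N)))
  regroup = solve-∀ ring

-- The factors are sorted by position modulo 3; each residue class contributes a power 3ⁿ.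
rising-triplication : ∀ a n → ⟨ fromℕ 3 * a ⟩ (n ℕ.* 3) ≡
                      fromℕ 27 ^ n * (⟨ a ⟩ n * ⟨ a + + 1 / 3 ⟩ n * ⟨ a + + 2 / 3 ⟩ n)
rising-triplication a zero    = refl
rising-triplication a (suc n) = begin
  R * (b + fromℕ M) * (b + fromℕ (1 ℕ.+ M)) * (b + fromℕ (2 ℕ.+ M))
    ≡⟨ cong₂ (λ y z → R * (b + fromℕ M) * (b + y) * (b + z)) (fromℕ-+ 1 M) (fromℕ-+ 2 M) ⟩
  R * (b + fromℕ M) * (b + (1ℚ + fromℕ M)) * (b + (2ℚ + fromℕ M))
    ≡⟨ cong₂ (λ x y → x * (b + y) * (b + (1ℚ + y)) * (b + (2ℚ + y))) (rising-triplication a n) (fromℕ-* n 3) ⟩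
  P * (X * Y * Z) * (b + N * fromℕ 3) * (b + (1ℚ + N * fromℕ 3)) * (b + (2ℚ + N * fromℕ 3))
    ≡⟨ regroup P X Y Z a N ⟩
  fromℕ 27 * P * (X * (a + N) * (Y * (a + + 1 / 3 + N)) * (Z * (a + + 2 / 3 + N))) ∎
  where
  b = fromℕ 3 * a
  M = n ℕ.* 3
  R = ⟨ b ⟩ M
  N = fromℕ n
  P = fromℕ 27 ^ n
  X = ⟨ a ⟩ n
  Y = ⟨ a + + 1 / 3 ⟩ n
  Z = ⟨ a + + 2 / 3 ⟩ n
  regroup : ∀ P X Y Z a N →
    P * (X * Y * Z) * (fromℕ 3 * a + N * fromℕ 3) * (fromℕ 3 * a + (1ℚ + N * fromℕ 3))
        * (fromℕ 3 * a + (2ℚ + N * fromℕ 3))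
      ≡ fromℕ 27 * P * (X * (a + N) * (Y * (a + + 1 / 3 + N)) * (Z * (a + + 2 / 3 + N)))
  regroup = solve-∀ ring

-- The factor at index `m` is -m + m = 0; the induction on `k` descends to it.
rising-vanishes : ∀ {m k} → m ℕ.< k → ⟨ - fromℕ m ⟩ k ≡ 0ℚ
rising-vanishes {m} {suc k} (ℕ.s≤s m≤k) with ℕ.m≤n⇒m<n∨m≡n m≤k
... | inj₁ m<k  = trans (cong (_* (- fromℕ m + fromℕ k)) (rising-vanishes m<k)) (*-zeroˡ (- fromℕ m + fromℕ k))
... | inj₂ refl = trans (cong (⟨ - fromℕ m ⟩ m *_) (+-inverseˡ (fromℕ m))) (*-zeroʳ (⟨ - fromℕ m ⟩ m))

-- Very-well-poised terms and their Wilf-Zeilberger pair.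

shifted-pos : ∀ m q .{{_ : Positive q}} → Positive (fromℕ m + q)
shifted-pos m q = nonNeg+pos⇒pos (fromℕ m) q

1+-pos : ∀ e .{{_ : Positive e}} → Positive (1ℚ + e)
1+-pos e = pos+pos⇒pos 1ℚ e

wpDen : ℚ → ℚ → ℕ → ℚ
wpDen d e k = fromℕ (k !) * ⟨ d ⟩ k * ⟨ e ⟩ k

wpDen≢0 : ∀ d e .{{_ : Positive d}} .{{_ : Positive e}} k → NonZero (wpDen d e k)
wpDen≢0 d e k =
  pos⇒nonZero (wpDen d e k)
    {{pos*pos⇒pos (fromℕ (k !) * ⟨ d ⟩ k)
        {{pos*pos⇒pos (fromℕ (k !)) {{factorial-pos k}} (⟨ d ⟩ k) {{rising-pos d k}}}}
        (⟨ e ⟩ k) {{rising-pos e k}}}}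

-- The very-well-poised term with numerator parameters a, b, c, written in terms
-- of the denominator parameters e = 1 + a - b and d = 1 + a - c.
wpTerm : ∀ (a d e : ℚ) .{{_ : Positive d}} .{{_ : Positive e}} → ℕ → ℚ
wpTerm a d e k =
  (- 1ℚ) ^ k * (a + 2ℚ * fromℕ k) *
  ((⟨ 1ℚ + a - e ⟩ k * ⟨ 1ℚ + a - d ⟩ k * ⟨ a ⟩ k) ÷ wpDen d e k) {{wpDen≢0 d e k}}

-- The denominator uses e / (e)_{j+1} = 1 / (1 + e)_j.
certificate : ∀ (a d e : ℚ) .{{_ : Positive d}} .{{_ : Positive e}} → ℕ → ℚ
certificate a d e zero    = 0ℚ
certificate a d e {{d>0}} (suc j) =
  (- 1ℚ) ^ suc j *
  ((⟨ 1ℚ + a - e ⟩ j * ⟨ 1ℚ + a - d ⟩ suc j * ⟨ a ⟩ suc j) ÷ wpDen d (1ℚ + e) j)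
    {{wpDen≢0 d (1ℚ + e) {{d>0}} {{1+-pos e}} j}}

-- At a positive index both terms and both certificate values are polynomial multiples of one
-- quotient `Q`, up to sign, so the relation reduces to the polynomial identity `core`.
wz-step : ∀ (a d e : ℚ) .{{d>0 : Positive d}} .{{_ : Positive e}} k →
  (d + e - a - 1ℚ) * wpTerm a d (1ℚ + e) {{d>0}} {{1+-pos e}} k - e * wpTerm a d e k
    ≡ certificate a d e (suc k) - certificate a d e k
-- At index 0 all denominators are empty products, so the quotients evaluate and a ring identity is
-- left.
wz-step a d e zero = base a d e
  where
  base : ∀ a d e →
    (d + e - a - 1ℚ) * (1ℚ * (a + 0ℚ) * 1ℚ) - e * (1ℚ * (a + 0ℚ) * 1ℚ)
      ≡ (- 1ℚ) * 1ℚ * ((1ℚ * (1ℚ * (1ℚ + a - d + 0ℚ)) * (1ℚ * (a + 0ℚ))) * 1ℚ) - 0ℚ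
  base = solve-∀ ring
wz-step a d e {{d>0}} {{e>0}} (suc j) = begin
  (d + e - a - 1ℚ) * (S * A * Q₁) - e * (S * A * Q₂)
    ≡⟨ expose S A a d e Q₁ Q₂ ⟩
  (d + e - a - 1ℚ) * S * A * Q₁ - S * A * (e * Q₂)
    ≡⟨ cong₂ (λ x y → (d + e - a - 1ℚ) * S * A * x - S * A * y) Q₁≡ Q₂≡ ⟩
  (d + e - a - 1ℚ) * S * A * ((a - e) * Q) - S * A * ((1ℚ + a - e + J) * (1ℚ + e + J) * Q)
    ≡⟨ cong (λ k → (d + e - a - 1ℚ) * S * (a + 2ℚ * k) * ((a - e) * Q)
              - S * (a + 2ℚ * k) * ((1ℚ + a - e + J) * (1ℚ + e + J) * Q)) (fromℕ-+ 1 j) ⟩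
  (d + e - a - 1ℚ) * S * (a + 2ℚ * (1ℚ + J)) * ((a - e) * Q)
    - S * (a + 2ℚ * (1ℚ + J)) * ((1ℚ + a - e + J) * (1ℚ + e + J) * Q)
    ≡⟨ core S Q a d e J ⟩
  - 1ℚ * S * ((1ℚ + a - e + J) * (1ℚ + a - d + (1ℚ + J)) * (a + (1ℚ + J)) * Q)
    - S * ((1ℚ + J) * (d + J) * (1ℚ + e + J) * Q)
    ≡⟨ cong₂ (λ x y → - 1ℚ * S * x - S * y) Q₄≡ Q₃≡ ⟨
  - 1ℚ * S * Q₄ - S * Q₃ ∎
  where
  S = (- 1ℚ) ^ suc j
  J = fromℕ j
  A = a + 2ℚ * fromℕ (suc j)
  p = ⟨ 1ℚ + a - e ⟩ j
  q = ⟨ 1ℚ + a - d ⟩ suc j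
  r = ⟨ a ⟩ suc j
  D₁ = wpDen d (1ℚ + e) (suc j)
  D₂ = wpDen d e (suc j)
  D₃ = wpDen d (1ℚ + e) j
  instance
    D₁≢0 : NonZero D₁
    D₁≢0 = wpDen≢0 d (1ℚ + e) {{d>0}} {{1+-pos e}} (suc j)
    D₂≢0 : NonZero D₂
    D₂≢0 = wpDen≢0 d e (suc j)
    D₃≢0 : NonZero D₃
    D₃≢0 = wpDen≢0 d (1ℚ + e) {{d>0}} {{1+-pos e}} j
  Q Q₁ Q₂ Q₃ Q₄ : ℚ
  -- The numerator is that of the certificate at `suc j`, the denominator that of the certificate
  -- one index later; with this choice all four multipliers are polynomials.
  Q  = (p * q * r) ÷ D₁
  Q₁ = (⟨ 1ℚ + a - (1ℚ + e) ⟩ suc j * q * r) ÷ D₁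
  Q₂ = (p * (1ℚ + a - e + J) * q * r) ÷ D₂
  Q₃ = (p * q * r) ÷ D₃
  Q₄ = (p * (1ℚ + a - e + J) * (q * (1ℚ + a - d + fromℕ (suc j))) * (r * (a + fromℕ (suc j)))) ÷ D₁

  expose : ∀ S A a d e Q₁ Q₂ →
    (d + e - a - 1ℚ) * (S * A * Q₁) - e * (S * A * Q₂)
      ≡ (d + e - a - 1ℚ) * S * A * Q₁ - S * A * (e * Q₂)
  expose = solve-∀ ring
  core : ∀ S Q a d e J →
    (d + e - a - 1ℚ) * S * (a + 2ℚ * (1ℚ + J)) * ((a - e) * Q)
      - S * (a + 2ℚ * (1ℚ + J)) * ((1ℚ + a - e + J) * (1ℚ + e + J) * Q)
      ≡ - 1ℚ * S * ((1ℚ + a - e + J) * (1ℚ + a - d + (1ℚ + J)) * (a + (1ℚ + J)) * Q)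
        - S * ((1ℚ + J) * (d + J) * (1ℚ + e + J) * Q)
  core = solve-∀ ring

  Q₁≡ : Q₁ ≡ (a - e) * Q
  Q₁≡ = ÷-cross (⟨ 1ℚ + a - (1ℚ + e) ⟩ suc j * q * r) (a - e) (p * q * r) (begin
    (⟨ 1ℚ + a - (1ℚ + e) ⟩ suc j * q * r) * D₁
      ≡⟨ cong (λ x → (x * q * r) * D₁) (trans (cong (⟨_⟩ suc j) (shift₁ a e)) (rising-step (a - e) j)) ⟩
    ((a - e) * ⟨ 1ℚ + (a - e) ⟩ j * q * r) * D₁
      ≡⟨ cong (λ x → ((a - e) * ⟨ x ⟩ j * q * r) * D₁) (+-assoc 1ℚ a (- e)) ⟨
    ((a - e) * p * q * r) * D₁
      ≡⟨ pull (a - e) p q r D₁ ⟩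
    (a - e) * (p * q * r) * D₁ ∎)
    where
    shift₁ : ∀ a e → 1ℚ + a - (1ℚ + e) ≡ a - e
    shift₁ = solve-∀ ring
    pull : ∀ s p q r D → (s * p * q * r) * D ≡ s * (p * q * r) * D
    pull = solve-∀ ring

  Q₂≡ : e * Q₂ ≡ (1ℚ + a - e + J) * (1ℚ + e + J) * Q
  Q₂≡ = trans (sym (*-assoc e (p * c * q * r) (1/ D₂))) (÷-cross (e * (p * c * q * r)) (c * (1ℚ + e + J)) (p * q * r) (begin
    e * (p * c * q * r) * (F * E * ⟨ 1ℚ + e ⟩ suc j)
      ≡⟨ pull e p c q r F E (⟨ 1ℚ + e ⟩ suc j) ⟩
    p * c * q * r * F * E * (e * ⟨ 1ℚ + e ⟩ suc j)
      -- Splitting (e)ⱼ₊₂ at its first and at its last factor exchanges the two denominators.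
      ≡⟨ cong (p * c * q * r * F * E *_) (rising-step e (suc j)) ⟨
    p * c * q * r * F * E * (⟨ e ⟩ suc j * (e + fromℕ (suc j)))
      ≡⟨ cong (λ k → p * c * q * r * F * E * (⟨ e ⟩ suc j * (e + k))) (fromℕ-+ 1 j) ⟩
    p * c * q * r * F * E * (⟨ e ⟩ suc j * (e + (1ℚ + J)))
      ≡⟨ push p c q r F E (⟨ e ⟩ suc j) e J ⟩
    c * (1ℚ + e + J) * (p * q * r) * (F * E * ⟨ e ⟩ suc j) ∎))
    where
    c = 1ℚ + a - e + J
    F = fromℕ (suc j !)
    E = ⟨ d ⟩ suc j
    pull : ∀ e p c q r F E x → e * (p * c * q * r) * (F * E * x) ≡ p * c * q * r * F * E * (e * x)
    pull = solve-∀ ring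
    push : ∀ p c q r F E x e J →
      p * c * q * r * F * E * (x * (e + (1ℚ + J))) ≡ c * (1ℚ + e + J) * (p * q * r) * (F * E * x)
    push = solve-∀ ring

  Q₃≡ : Q₃ ≡ (1ℚ + J) * (d + J) * (1ℚ + e + J) * Q
  Q₃≡ = ÷-cross (p * q * r) ((1ℚ + J) * (d + J) * (1ℚ + e + J)) (p * q * r) (begin
    (p * q * r) * (fromℕ (suc j !) * (E * (d + J)) * (G * (1ℚ + e + J)))
      ≡⟨ cong (λ x → (p * q * r) * (x * (E * (d + J)) * (G * (1ℚ + e + J))))
           (trans (fromℕ-* (suc j) (j !)) (cong (_* fromℕ (j !)) (fromℕ-+ 1 j))) ⟩
    (p * q * r) * ((1ℚ + J) * F * (E * (d + J)) * (G * (1ℚ + e + J)))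
      ≡⟨ regroup (p * q * r) (1ℚ + J) F E (d + J) G (1ℚ + e + J) ⟩
    (1ℚ + J) * (d + J) * (1ℚ + e + J) * (p * q * r) * (F * E * G) ∎)
    where
    F = fromℕ (j !)
    E = ⟨ d ⟩ j
    G = ⟨ 1ℚ + e ⟩ j
    regroup : ∀ N x F E y G z → N * (x * F * (E * y) * (G * z)) ≡ x * y * z * N * (F * E * G)
    regroup = solve-∀ ring

  Q₄≡ : Q₄ ≡ (1ℚ + a - e + J) * (1ℚ + a - d + (1ℚ + J)) * (a + (1ℚ + J)) * Q
  Q₄≡ = ÷-cross (p * c * (q * (1ℚ + a - d + fromℕ (suc j))) * (r * (a + fromℕ (suc j))))
    (c * (1ℚ + a - d + (1ℚ + J)) * (a + (1ℚ + J))) (p * q * r) (begin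
    (p * c * (q * (1ℚ + a - d + fromℕ (suc j))) * (r * (a + fromℕ (suc j)))) * D₁
      ≡⟨ cong (λ k → (p * c * (q * (1ℚ + a - d + k)) * (r * (a + k))) * D₁) (fromℕ-+ 1 j) ⟩
    (p * c * (q * (1ℚ + a - d + (1ℚ + J))) * (r * (a + (1ℚ + J)))) * D₁
      ≡⟨ regroup p c q (1ℚ + a - d + (1ℚ + J)) r (a + (1ℚ + J)) D₁ ⟩
    c * (1ℚ + a - d + (1ℚ + J)) * (a + (1ℚ + J)) * (p * q * r) * D₁ ∎)
    where
    c = 1ℚ + a - e + J
    regroup : ∀ p x q y r z D → (p * x * (q * y) * (r * z)) * D ≡ x * y * z * (p * q * r) * D
    regroup = solve-∀ ring

-- Partial sums and telescoping.

partialSum : (ℕ → ℚ) → ℕ → ℚ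
partialSum f N = sum {N} λ i → f (toℕ i)

partialSum-zero : ∀ f → (∀ k → f k ≡ 0ℚ) → ∀ N → partialSum f N ≡ 0ℚ
partialSum-zero f f≡0 N = trans (sum-cong-≗ {N} λ i → f≡0 (toℕ i)) (sum-replicate-zero N)

-- `sum` unfolds at its first term, so the induction shifts all three sequences and the intermediate
-- value `G 1` cancels.
telescope : ∀ x y (f g G : ℕ → ℚ) → (∀ k → x * f k - y * g k ≡ G (suc k) - G k) →
            ∀ N → x * partialSum f N - y * partialSum g N ≡ G N - G 0
telescope x y f g G step zero    = empty x y (G 0)
  where
  empty : ∀ x y z → x * 0ℚ - y * 0ℚ ≡ z - z
  empty = solve-∀ ring
telescope x y f g G step (suc N) = begin
  x * (f 0 + partialSum (f ∘ suc) N) - y * (g 0 + partialSum (g ∘ suc) N)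
    ≡⟨ split x y (f 0) (g 0) (partialSum (f ∘ suc) N) (partialSum (g ∘ suc) N) ⟩
  (x * f 0 - y * g 0) + (x * partialSum (f ∘ suc) N - y * partialSum (g ∘ suc) N)
    ≡⟨ cong₂ _+_ (step 0) (telescope x y (f ∘ suc) (g ∘ suc) (G ∘ suc) (step ∘ suc) N) ⟩
  (G 1 - G 0) + (G (suc N) - G 1)
    ≡⟨ collapse (G 0) (G 1) (G (suc N)) ⟩
  G (suc N) - G 0 ∎
  where
  split : ∀ x y u v s t → x * (u + s) - y * (v + t) ≡ (x * u - y * v) + (x * s - y * t)
  split = solve-∀ ring
  collapse : ∀ u v w → (v - u) + (w - v) ≡ w - u
  collapse = solve-∀ ring

-- The terminating very-well-poised summation.

complement : ∀ m s → s - (fromℕ m + s) ≡ - fromℕ m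
complement m = identity (fromℕ m)
  where
  identity : ∀ x s → s - (x + s) ≡ - x
  identity = solve-∀ ring

zero-* : ∀ {x} y z → x ≡ 0ℚ → x * y * z ≡ 0ℚ
zero-* y z refl = trans (cong (_* z) (*-zeroˡ y)) (*-zeroˡ z)

-- With e = m + 1 + a the first numerator parameter 1 + a - e is -m.
wpTerm-vanishes : ∀ (a d : ℚ) .{{_ : Positive d}} m .{{_ : Positive (fromℕ m + (1ℚ + a))}} {k} →
                  m ℕ.< k → wpTerm a d (fromℕ m + (1ℚ + a)) k ≡ 0ℚ
wpTerm-vanishes a d {{d>0}} m {{e>0}} {k} m<k =
  trans (cong ((- 1ℚ) ^ k * (a + 2ℚ * fromℕ k) *_)
          (÷-zero {{wpDen≢0 d (fromℕ m + (1ℚ + a)) k}} (zero-* (⟨ 1ℚ + a - d ⟩ k) (⟨ a ⟩ k)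
            (trans (cong (⟨_⟩ k) (complement m (1ℚ + a))) (rising-vanishes m<k)))))
        (*-zeroʳ ((- 1ℚ) ^ k * (a + 2ℚ * fromℕ k)))

-- The bound is one larger than for the terms, because the certificate at index k contains (-m)ₖ₋₁.
certificate-vanishes : ∀ (a d : ℚ) .{{_ : Positive d}} m .{{_ : Positive (fromℕ m + (1ℚ + a))}} {k} →
                       suc m ℕ.< k → certificate a d (fromℕ m + (1ℚ + a)) k ≡ 0ℚ
certificate-vanishes a d {{d>0}} m {{e>0}} {suc k} (ℕ.s≤s m<k) =
  trans (cong ((- 1ℚ) ^ suc k *_)
          (÷-zero {{wpDen≢0 d (1ℚ + (fromℕ m + (1ℚ + a))) {{d>0}} {{1+-pos (fromℕ m + (1ℚ + a))}} k}}
            (zero-* (⟨ 1ℚ + a - d ⟩ suc k) (⟨ a ⟩ suc k)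
              (trans (cong (⟨_⟩ k) (complement m (1ℚ + a))) (rising-vanishes m<k)))))
        (*-zeroʳ ((- 1ℚ) ^ suc k))

-- The positivity proofs depend on `e` but are irrelevant, so matching on the equation identifies
-- the two terms.
wpTerm-congᵉ : ∀ a d .{{_ : Positive d}} {e e′} .{{_ : Positive e}} .{{_ : Positive e′}} →
               e ≡ e′ → ∀ k → wpTerm a d e k ≡ wpTerm a d e′ k
wpTerm-congᵉ a d refl k = refl

-- Induction on `m`, summing the contiguity relation over k. The cutoff `N` is any number above `m`,
-- so that the sums for `m` and `suc m` can be compared over the same range.
wellPoised-sum : ∀ (a d : ℚ) .{{d>0 : Positive d}} .{{1+a>0 : Positive (1ℚ + a)}} m {N} → m ℕ.< N →
  ⟨ d ⟩ m * partialSum (wpTerm a d (fromℕ m + (1ℚ + a)) {{d>0}} {{shifted-pos m (1ℚ + a)}}) N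
    ≡ a * ⟨ 1ℚ + a ⟩ m
wellPoised-sum a d {{d>0}} zero {suc N} _ = begin
  1ℚ * (1ℚ * (a + 0ℚ) * 1ℚ + partialSum (term ∘ suc) N)
    ≡⟨ cong (λ x → 1ℚ * (1ℚ * (a + 0ℚ) * 1ℚ + x))
         (partialSum-zero (term ∘ suc) (λ k → wpTerm-vanishes a d 0 {{shifted-pos 0 (1ℚ + a)}} {suc k} (ℕ.s≤s ℕ.z≤n)) N) ⟩
  1ℚ * (1ℚ * (a + 0ℚ) * 1ℚ + 0ℚ)
    ≡⟨ simplify a ⟩
  a * 1ℚ ∎
  where
  term = wpTerm a d (fromℕ 0 + (1ℚ + a)) {{d>0}} {{shifted-pos 0 (1ℚ + a)}}
  simplify : ∀ a → 1ℚ * (1ℚ * (a + 0ℚ) * 1ℚ + 0ℚ) ≡ a * 1ℚ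
  simplify = solve-∀ ring
wellPoised-sum a d {{d>0}} (suc m) {N} m<N = begin
  ⟨ d ⟩ m * (d + M) * partialSum term″ N
    ≡⟨ cong (⟨ d ⟩ m * (d + M) *_) (sum-cong-≗ {N} λ i → wpTerm-congᵉ a d shift (toℕ i)) ⟩
  ⟨ d ⟩ m * (d + M) * S′
    -- For e = m + 1 + a the coefficient d + e - a - 1 equals d + m, the new factor of (d)ₘ₊₁.
    ≡⟨ toContiguous (⟨ d ⟩ m) d M a S S′ ⟩
  ⟨ d ⟩ m * ((d + e - a - 1ℚ) * S′ - e * S + e * S)
    ≡⟨ cong (λ x → ⟨ d ⟩ m * (x + e * S))
         (telescope (d + e - a - 1ℚ) e (wpTerm a d (1ℚ + e)) (wpTerm a d e) (certificate a d e) (wz-step a d e) N) ⟩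
  ⟨ d ⟩ m * (certificate a d e N - 0ℚ + e * S)
    -- The hypothesis is now `suc m < N`, which kills the certificate at the upper end; at the lower
    -- end it is 0 by definition.
    ≡⟨ cong (λ x → ⟨ d ⟩ m * (x - 0ℚ + e * S)) (certificate-vanishes a d m m<N) ⟩
  ⟨ d ⟩ m * (0ℚ - 0ℚ + e * S)
    ≡⟨ regroup (⟨ d ⟩ m) e S ⟩
  e * (⟨ d ⟩ m * S)
    ≡⟨ cong (e *_) (wellPoised-sum a d m (ℕ.<-trans (ℕ.n<1+n m) m<N)) ⟩
  e * (a * ⟨ 1ℚ + a ⟩ m)
    ≡⟨ finish M a (⟨ 1ℚ + a ⟩ m) ⟩
  a * (⟨ 1ℚ + a ⟩ m * (1ℚ + a + M)) ∎
  where
  M = fromℕ m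
  e = M + (1ℚ + a)
  instance
    e>0 : Positive e
    e>0 = shifted-pos m (1ℚ + a)
    1+e>0 : Positive (1ℚ + e)
    1+e>0 = 1+-pos e
    e″>0 : Positive (fromℕ (suc m) + (1ℚ + a))
    e″>0 = shifted-pos (suc m) (1ℚ + a)
  term″ = wpTerm a d (fromℕ (suc m) + (1ℚ + a))
  S  = partialSum (wpTerm a d e) N
  S′ = partialSum (wpTerm a d (1ℚ + e)) N
  shift : fromℕ (suc m) + (1ℚ + a) ≡ 1ℚ + e
  shift = trans (cong (_+ (1ℚ + a)) (fromℕ-+ 1 m)) (+-assoc 1ℚ M (1ℚ + a))
  toContiguous : ∀ R d M a S S′ → R * (d + M) * S′ ≡
    R * ((d + (M + (1ℚ + a)) - a - 1ℚ) * S′ - (M + (1ℚ + a)) * S + (M + (1ℚ + a)) * S)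
  toContiguous = solve-∀ ring
  regroup : ∀ R e S → R * (0ℚ - 0ℚ + e * S) ≡ e * (R * S)
  regroup = solve-∀ ring
  finish : ∀ M a R → (M + (1ℚ + a)) * (a * R) ≡ a * (R * (1ℚ + a + M))
  finish = solve-∀ ring

-- Specialisation to the series and evaluation of its sum.

-- Here 4k + 1 = 2(½ + 2k), while 1 + a - e and 1 + a - d become -2n and ¼ - n.
summand≡2*wpTerm : ∀ n k →
  summand n k ≡ 2ℚ * wpTerm ½ (fromℕ n + + 5 / 4) (fromℕ (2 ℕ.* n) + + 3 / 2)
    {{shifted-pos n (+ 5 / 4)}} {{shifted-pos (2 ℕ.* n) (+ 3 / 2)}} k
summand≡2*wpTerm n k = begin
  X * fromℕ (4 ℕ.* k ℕ.+ 1) * (⟨ - fromℕ (2 ℕ.* n) ⟩ k * ⟨ - fromℕ n + + 1 / 4 ⟩ k * ⟨ ½ ⟩ k * i)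
    ≡⟨ cong₂ (λ x y → X * x * (y * ⟨ ½ ⟩ k * i))
         (trans (fromℕ-+ (4 ℕ.* k) 1) (cong (_+ 1ℚ) (fromℕ-* 4 k)))
         (cong₂ (λ x y → ⟨ x ⟩ k * ⟨ y ⟩ k) (sym (complement (2 ℕ.* n) (+ 3 / 2))) (reflect (fromℕ n))) ⟩
  X * (fromℕ 4 * fromℕ k + 1ℚ) * (B * C * ⟨ ½ ⟩ k * i)
    ≡⟨ double X (fromℕ k) (B * C * ⟨ ½ ⟩ k * i) ⟩
  2ℚ * (X * (½ + 2ℚ * fromℕ k) * (B * C * ⟨ ½ ⟩ k * i)) ∎
  where
  X = (- 1ℚ) ^ k
  B = ⟨ + 3 / 2 - (fromℕ (2 ℕ.* n) + + 3 / 2) ⟩ k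
  C = ⟨ + 3 / 2 - (fromℕ n + + 5 / 4) ⟩ k
  i = (1/ summandDenominator n k) {{summandDenominator≢0 n k}}
  reflect : ∀ x → - x + + 1 / 4 ≡ + 3 / 2 - (x + + 5 / 4)
  reflect = solve-∀ ring
  double : ∀ X K Q → X * (fromℕ 4 * K + 1ℚ) * Q ≡ 2ℚ * (X * (½ + 2ℚ * K) * Q)
  double = solve-∀ ring

partialSum-summand : ∀ n {N} → 2 ℕ.* n ℕ.< N →
  ⟨ fromℕ n + + 5 / 4 ⟩ (2 ℕ.* n) * partialSum (summand n) N ≡ ⟨ + 3 / 2 ⟩ (2 ℕ.* n)
partialSum-summand n {N} 2n<N = begin
  D * partialSum (summand n) N
    ≡⟨ cong (D *_) (sum-cong-≗ {N} λ i → summand≡2*wpTerm n (toℕ i)) ⟩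
  D * partialSum ((2ℚ *_) ∘ term) N
    ≡⟨ cong (D *_) (*-distribˡ-sum {N} 2ℚ (term ∘ toℕ)) ⟨
  D * (2ℚ * partialSum term N)
    ≡⟨ swap D (partialSum term N) ⟩
  2ℚ * (D * partialSum term N)
    -- `1ℚ + ½` evaluates to 3/2, so the parameter 2n + 3/2 has the required form m + (1 + a) with m
    -- = 2n.
    ≡⟨ cong (2ℚ *_) (wellPoised-sum ½ d {{shifted-pos n (+ 5 / 4)}} (2 ℕ.* n) 2n<N) ⟩
  2ℚ * (½ * ⟨ + 3 / 2 ⟩ (2 ℕ.* n))
    ≡⟨ cancel (⟨ + 3 / 2 ⟩ (2 ℕ.* n)) ⟩
  ⟨ + 3 / 2 ⟩ (2 ℕ.* n) ∎
  where
  d = fromℕ n + + 5 / 4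
  D = ⟨ d ⟩ (2 ℕ.* n)
  term = wpTerm ½ d (fromℕ (2 ℕ.* n) + + 3 / 2)
    {{shifted-pos n (+ 5 / 4)}} {{shifted-pos (2 ℕ.* n) (+ 3 / 2)}}
  swap : ∀ D S → D * (2ℚ * S) ≡ 2ℚ * (D * S)
  swap = solve-∀ ring
  cancel : ∀ x → 2ℚ * (½ * x) ≡ x
  cancel = solve-∀ ring

value-rising : ∀ n → value n * ⟨ + 5 / 4 ⟩ (n ℕ.* 3) ≡ ⟨ + 5 / 4 ⟩ n * ⟨ + 3 / 2 ⟩ (2 ℕ.* n)
value-rising n = begin
  c ^ n * V * ⟨ + 5 / 4 ⟩ (n ℕ.* 3)
    -- 5/4 is 3 times 5/12, and adding 1/3 and 2/3 to 5/12 gives 3/4 and 13/12.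
    ≡⟨ cong (c ^ n * V *_) (rising-triplication (+ 5 / 12) n) ⟩
  c ^ n * V * (fromℕ 27 ^ n * (X * Y * Z))
    ≡⟨ gather (c ^ n) V (fromℕ 27 ^ n) X Y Z ⟩
  (c ^ n * fromℕ 27 ^ n) * (V * (Z * X)) * Y
    -- The product of 4/27 and 27 evaluates to 4, and `Z * X` is exactly the denominator of `V`.
    ≡⟨ cong₂ (λ x y → x * y * Y) (sym (^-distrib-* c (fromℕ 27) n))
         (÷-*-cancel (F ^ 2) (valueDenominator n) {{valueDenominator≢0 n}}) ⟩
  fromℕ 4 ^ n * (F * (F * 1ℚ)) * Y
    ≡⟨ regroup (fromℕ 4 ^ n) F Y ⟩
  F * (fromℕ 4 ^ n * (Y * F))
    ≡⟨ cong (F *_) (rising-duplication (+ 3 / 4) n) ⟨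
  F * ⟨ + 3 / 2 ⟩ (n ℕ.* 2)
    ≡⟨ cong (λ k → F * ⟨ + 3 / 2 ⟩ k) (ℕ.*-comm n 2) ⟩
  F * ⟨ + 3 / 2 ⟩ (2 ℕ.* n) ∎
  where
  c = + (2 ℕ.^ 2) / (3 ℕ.^ 3)
  F = ⟨ + 5 / 4 ⟩ n
  X = ⟨ + 5 / 12 ⟩ n
  Y = ⟨ + 3 / 4 ⟩ n
  Z = ⟨ + 13 / 12 ⟩ n
  V = (F ^ 2 ÷ valueDenominator n) {{valueDenominator≢0 n}}
  gather : ∀ p V q X Y Z → p * V * (q * (X * Y * Z)) ≡ (p * q) * (V * (Z * X)) * Y
  gather = solve-∀ ring
  regroup : ∀ p F Y → p * (F * (F * 1ℚ)) * Y ≡ F * (p * (Y * F))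
  regroup = solve-∀ ring

theorem3 : (n : ℕ) → summand n HasFiniteSum value n
-- The indices 0 to 2n carry the sum. Both sides are multiplied by the positive number (5/4)₃ₙ,
-- which splits into (5/4)ₙ and the factor (n + 5/4)₂ₙ of the summation formula.
theorem3 n = suc (2 ℕ.* n) , vanishes , *-cancelʳ (⟨ + 5 / 4 ⟩ (n ℕ.* 3)) {{rising≢0}} (begin
  S * ⟨ + 5 / 4 ⟩ (n ℕ.* 3)
    ≡⟨ cong (λ k → S * ⟨ + 5 / 4 ⟩ k) (ℕ.*-comm n 3) ⟩
  S * ⟨ + 5 / 4 ⟩ (n ℕ.+ 2 ℕ.* n)
    ≡⟨ cong (S *_) (rising-+ (+ 5 / 4) n (2 ℕ.* n)) ⟩
  S * (⟨ + 5 / 4 ⟩ n * ⟨ fromℕ n + + 5 / 4 ⟩ (2 ℕ.* n))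
    ≡⟨ rotate S (⟨ + 5 / 4 ⟩ n) (⟨ fromℕ n + + 5 / 4 ⟩ (2 ℕ.* n)) ⟩
  ⟨ + 5 / 4 ⟩ n * (⟨ fromℕ n + + 5 / 4 ⟩ (2 ℕ.* n) * S)
    ≡⟨ cong (⟨ + 5 / 4 ⟩ n *_) (partialSum-summand n (ℕ.n<1+n (2 ℕ.* n))) ⟩
  ⟨ + 5 / 4 ⟩ n * ⟨ + 3 / 2 ⟩ (2 ℕ.* n)
    ≡⟨ value-rising n ⟨
  value n * ⟨ + 5 / 4 ⟩ (n ℕ.* 3) ∎)
  where
  S = partialSum (summand n) (suc (2 ℕ.* n))
  rising≢0 : NonZero (⟨ + 5 / 4 ⟩ (n ℕ.* 3))
  rising≢0 = pos⇒nonZero (⟨ + 5 / 4 ⟩ (n ℕ.* 3)) {{rising-pos (+ 5 / 4) (n ℕ.* 3)}}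
  vanishes : ∀ k → 2 ℕ.* n ℕ.< k → summand n k ≡ 0ℚ
  vanishes k 2n<k = trans (summand≡2*wpTerm n k) (cong (2ℚ *_)
    (wpTerm-vanishes ½ (fromℕ n + + 5 / 4) {{shifted-pos n (+ 5 / 4)}}
      (2 ℕ.* n) {{shifted-pos (2 ℕ.* n) (+ 3 / 2)}} 2n<k))
  rotate : ∀ S F D → S * (F * D) ≡ F * (D * S)
  rotate = solve-∀ ring
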